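{- For $n\ge1$, the number of equivalence classes of period configurations of Parallel Diffusion on the labelled complete graph $K_n$ (vertex set $\{1,\dots,n\}$) equals $$\sum_{(B_1,\dots,B_N)}\ \prod_{i=2}^{N}\bigl(|B_{i-1}|+|B_i|-1\bigr),$$ where the sum runs over all ordered set partitions $(B_1,\dots,B_N)$ of $\{1,\dots,n\}$ into nonempty blocks (any $N\ge1$), and the empty product (for $N=1$) equals $1$.
   Context: Parallel Diffusion on a graph $G$: a configuration assigns an integer stack size $|v|$ to each vertex. One firing step replaces every stack size simultaneously by $|v| + \#\{u\in N(v): |u|>|v|\} - \#\{u\in N(v): |u|<|v|\}$. A period configuration is a configuration $D$ such that repeated firing starting from $D$ returns to $D$ after some positive number of steps. Two configurations on the same labelled graph are equivalent if one is obtained from the other by adding the same integer to every vertex's stack size. (The ordered partition $(B_1,\dots,B_N)$ records which vertices share each of the $N$ distinct stack sizes, listed in increasing order of stack size.) -}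

module Defs where

open import Data.Fin.Base using (Fin; zero; suc)
open import Data.Fin.Properties using (_≟_; all?; injective⇒≤)
open import Data.Fin.Subset using (Subset; inside; outside; _∈_; _∩_; ∣_∣; Nonempty; Empty)
open import Data.Fin.Subset.Properties using (nonempty?; _∈?_; x∈p∩q⁺)
open import Data.Integer.Base as ℤ using (ℤ; +_; 0ℤ)
import Data.Integer.Properties as ℤ
open import Data.List.Base using (List; []; _∷_; _++_; map; filter; length; lookup; allFin; upTo; concatMap; cartesianProductWith)
open import Data.List.Membership.Propositional using (lose) renaming (_∈_ to _∈ˡ_)
open import Data.List.Membership.Propositional.Properties
  using (∈-filter⁺; ∈-filter⁻; ∈-concatMap⁺; ∈-cartesianProductWith⁺; ∈-cartesianProductWith⁻; ∈-upTo⁺; ∈-map⁺; ∈-map⁻; ∈-++⁺ˡ; ∈-++⁺ʳ; ∈-lookup)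
open import Data.List.Properties using (∷-injective)
open import Data.List.Relation.Unary.All as All using (All; []; _∷_)
import Data.List.Relation.Unary.All.Properties as All
open import Data.List.Relation.Unary.AllPairs as AllPairs using (AllPairs; []; _∷_; allPairs?)
import Data.List.Relation.Unary.AllPairs.Properties as AllPairs
open import Data.List.Relation.Unary.Any as Any using (Any; here; there)
open import Data.List.Relation.Unary.Unique.Propositional using (Unique)
import Data.List.Relation.Unary.Unique.Propositional.Properties as Unique
open import Data.Nat.Base as ℕ using (ℕ; zero; suc; _<_; s≤s)
open import Data.Nat.GeneralisedArithmetic using (fold)
open import Data.Product.Base using (Σ; ∃; _×_; _,_; proj₁; proj₂)
import Data.Vec.Base as Vec
import Data.Vec.Properties as Vec
open import Function.Base using (_∘_; _on_)
open import Function.Bundles using (_⇔_; mk⇔; Bijection)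
open import Level using (0ℓ)
open import Relation.Binary.Bundles using (Setoid)
open import Relation.Binary.Core using (Rel)
open import Relation.Binary.Definitions using (Decidable; Symmetric; Irreflexive)
import Relation.Binary.Construct.On as On
open import Relation.Binary.PropositionalEquality
  using (_≡_; _≢_; refl; sym; trans; cong; subst; _≗_; setoid; ≢-sym)
open import Relation.Binary.Structures using (IsEquivalence)
open import Relation.Nullary.Decidable using (Dec; ¬?; _×-dec_; map′)
open import Relation.Nullary.Negation using (¬_; contradiction)

record Graph (n : ℕ) : Set₁ where
  field
    Adj        : Rel (Fin n) 0ℓ
    adj?       : Decidable Adj
    adj-sym    : Symmetric Adj
    adj-irrefl : Irreflexive _≡_ Adj

complete : (n : ℕ) → Graph n
complete n = record
  { Adj        = _≢_
  ; adj?       = λ u v → ¬? (u ≟ v)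
  ; adj-sym    = ≢-sym
  ; adj-irrefl = λ u≡v u≢v → u≢v u≡v
  }

Configuration : ℕ → Set
Configuration n = Fin n → ℤ

module ParallelDiffusion {n : ℕ} (G : Graph n) where
  open Graph G

  #richer : Configuration n → Fin n → ℕ
  #richer c v = length (filter (λ u → adj? v u ×-dec (c v ℤ.<? c u)) (allFin n))

  #poorer : Configuration n → Fin n → ℕ
  #poorer c v = length (filter (λ u → adj? v u ×-dec (c u ℤ.<? c v)) (allFin n))

  fire : Configuration n → Configuration n
  fire c v = c v ℤ.+ + #richer c v ℤ.- + #poorer c v

  IsPeriod : Configuration n → Set
  IsPeriod c = ∃ λ k → 0 < k × fold c fire k ≗ c

  PeriodConfiguration : Set
  PeriodConfiguration = Σ (Configuration n) IsPeriod

infix 4 _∼_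

_∼_ : ∀ {n} → Rel (Configuration n) 0ℓ
c ∼ d = ∃ λ k → ∀ v → d v ≡ c v ℤ.+ k

∼-isEquivalence : ∀ {n} → IsEquivalence (_∼_ {n})
∼-isEquivalence = record
  { refl  = λ {c} → 0ℤ , λ v → sym (ℤ.+-identityʳ (c v))
  ; sym   = λ {c} {d} (k , d≡c+k) → ℤ.- k , λ v → sym
      (trans (cong (λ i → i ℤ.- k) (d≡c+k v))
      (trans (ℤ.+-assoc (c v) k (ℤ.- k))
      (trans (cong (λ i → c v ℤ.+ i) (ℤ.+-inverseʳ k)) (ℤ.+-identityʳ (c v)))))
  ; trans = λ {c} {d} {e} (k , d≡c+k) (l , e≡d+l) → k ℤ.+ l , λ v →
      trans (e≡d+l v) (trans (cong (λ i → i ℤ.+ l) (d≡c+k v)) (ℤ.+-assoc (c v) k l))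
  }

-- The quotient of the period configurations by ∼, presented as a setoid: the
-- proof of periodicity plays no role in the equality.
periodClasses : ∀ {n} → Graph n → Setoid 0ℓ 0ℓ
periodClasses G = record
  { Carrier       = PeriodConfiguration
  ; _≈_           = _∼_ on proj₁
  ; isEquivalence = On.isEquivalence proj₁ ∼-isEquivalence
  }
  where open ParallelDiffusion G

HasCardinality : Setoid 0ℓ 0ℓ → ℕ → Set
HasCardinality S k = Bijection (setoid (Fin k)) S

Disjoint : ∀ {n} → Rel (Subset n) 0ℓ
Disjoint p q = Empty (p ∩ q)

record IsOrderedPartition {n : ℕ} (Bs : List (Subset n)) : Set where
  constructor mkIsOrderedPartition
  field
    nonempty : All Nonempty Bs
    disjoint : AllPairs Disjoint Bs
    covers   : ∀ v → Any (v ∈_) Bs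

isOrderedPartition? : ∀ {n} (Bs : List (Subset n)) → Dec (IsOrderedPartition Bs)
isOrderedPartition? Bs = map′
  (λ (ne , dj , cv) → mkIsOrderedPartition ne dj cv)
  (λ (mkIsOrderedPartition ne dj cv) → ne , dj , cv)
  (All.all? nonempty? Bs
    ×-dec allPairs? (λ p q → ¬? (nonempty? (p ∩ q))) Bs
    ×-dec all? (λ v → Any.any? (v ∈?_) Bs))

subsets : ∀ n → List (Subset n)
subsets zero    = Vec.[] ∷ []
subsets (suc n) = map (outside Vec.∷_) (subsets n) ++ map (inside Vec.∷_) (subsets n)

subsetLists : ∀ n → ℕ → List (List (Subset n))
subsetLists n zero    = [] ∷ []
subsetLists n (suc N) = cartesianProductWith _∷_ (subsets n) (subsetLists n N)

-- Restricting to at most n blocks loses nothing, since the blocks are nonempty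
-- and disjoint: ∈-orderedPartitions and orderedPartitions-unique below show
-- that every ordered partition is listed exactly once.
orderedPartitions : ∀ n → List (List (Subset n))
orderedPartitions n =
  filter isOrderedPartition? (concatMap (subsetLists n) (upTo (suc n)))

-- The truncated subtraction is exact on nonempty blocks.
blockProduct : ∀ {n} → List (Subset n) → ℕ
blockProduct []           = 1
blockProduct (B ∷ [])     = 1
blockProduct (B ∷ C ∷ Bs) = (∣ B ∣ ℕ.+ ∣ C ∣ ℕ.∸ 1) ℕ.* blockProduct (C ∷ Bs)

∈-subsets : ∀ {n} (p : Subset n) → p ∈ˡ subsets n
∈-subsets Vec.[]            = here refl
∈-subsets (outside Vec.∷ p) = ∈-++⁺ˡ (∈-map⁺ _ (∈-subsets p))
∈-subsets (inside  Vec.∷ p) = ∈-++⁺ʳ (map (outside Vec.∷_) (subsets _)) (∈-map⁺ _ (∈-subsets p))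

subsets-unique : ∀ n → Unique (subsets n)
subsets-unique zero    = [] ∷ []
subsets-unique (suc n) = Unique.++⁺
  (Unique.map⁺ Vec.∷-injectiveʳ (subsets-unique n))
  (Unique.map⁺ Vec.∷-injectiveʳ (subsets-unique n))
  λ (p∈l , p∈r) → outside≢inside p∈l p∈r
  where
  outside≢inside : ∀ {p} → p ∈ˡ map (outside Vec.∷_) (subsets n) → ¬ p ∈ˡ map (inside Vec.∷_) (subsets n)
  outside≢inside p∈l p∈r with ∈-map⁻ _ p∈l | ∈-map⁻ _ p∈r
  ... | _ , _ , refl | _ , _ , ()

∈-subsetLists : ∀ {n} (Bs : List (Subset n)) → Bs ∈ˡ subsetLists n (length Bs)
∈-subsetLists []       = here refl
∈-subsetLists (B ∷ Bs) = ∈-cartesianProductWith⁺ _∷_ (∈-subsets B) (∈-subsetLists Bs)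

subsetLists-length : ∀ {n} N {Bs : List (Subset n)} → Bs ∈ˡ subsetLists n N → length Bs ≡ N
subsetLists-length zero    (here refl) = refl
subsetLists-length (suc N) Bs∈ with ∈-cartesianProductWith⁻ _∷_ (subsets _) (subsetLists _ N) Bs∈
... | _ , _ , _ , Cs∈ , refl = cong suc (subsetLists-length N Cs∈)

subsetLists-unique : ∀ n N → Unique (subsetLists n N)
subsetLists-unique n zero    = [] ∷ []
subsetLists-unique n (suc N) =
  Unique.cartesianProductWith⁺ _∷_ ∷-injective (subsets-unique n) (subsetLists-unique n N)

disjoint-lookup : ∀ {n} {Bs : List (Subset n)} → AllPairs Disjoint Bs →
  ∀ i j {v} → v ∈ lookup Bs i → v ∈ lookup Bs j → i ≡ j
disjoint-lookup (d ∷ ds) zero    zero    v∈i v∈j = refl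
disjoint-lookup (d ∷ ds) zero    (suc j) v∈i v∈j = contradiction (_ , x∈p∩q⁺ (v∈i , v∈j)) (All.lookup d (∈-lookup j))
disjoint-lookup (d ∷ ds) (suc i) zero    v∈i v∈j = contradiction (_ , x∈p∩q⁺ (v∈j , v∈i)) (All.lookup d (∈-lookup i))
disjoint-lookup (d ∷ ds) (suc i) (suc j) v∈i v∈j = cong suc (disjoint-lookup ds i j v∈i v∈j)

orderedPartition-length : ∀ {n} {Bs : List (Subset n)} → IsOrderedPartition Bs → length Bs ℕ.≤ n
orderedPartition-length {n} {Bs} part = injective⇒≤ {f = proj₁ ∘ element} injective
  where
  open IsOrderedPartition part
  element : ∀ i → Nonempty (lookup Bs i)
  element i = All.lookup nonempty (∈-lookup i)
  injective : ∀ {i j} → proj₁ (element i) ≡ proj₁ (element j) → i ≡ j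
  injective {i} {j} eq = disjoint-lookup disjoint i j
    (proj₂ (element i)) (subst (_∈ lookup Bs j) (sym eq) (proj₂ (element j)))

∈-orderedPartitions : ∀ {n} (Bs : List (Subset n)) →
  Bs ∈ˡ orderedPartitions n ⇔ IsOrderedPartition Bs
∈-orderedPartitions {n} Bs = mk⇔
  (λ Bs∈ → proj₂ (∈-filter⁻ isOrderedPartition? {xs = concatMap (subsetLists n) (upTo (suc n))} Bs∈))
  (λ part → ∈-filter⁺ isOrderedPartition?
    (∈-concatMap⁺ (subsetLists n)
      (lose (∈-upTo⁺ (s≤s (orderedPartition-length part))) (∈-subsetLists Bs)))
    part)

orderedPartitions-unique : ∀ n → Unique (orderedPartitions n)
orderedPartitions-unique n = Unique.filter⁺ isOrderedPartition? (Unique.concat⁺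
  (All.map⁺ (All.universal (subsetLists-unique n) (upTo (suc n))))
  (AllPairs.map⁺ (AllPairs.map
    (λ {M} {N} M≢N {Bs} → disjoint M≢N {Bs})
    (Unique.upTo⁺ (suc n)))))
  where
  disjoint : ∀ {M N} → M ≢ N → ∀ {Bs} → ¬ (Bs ∈ˡ subsetLists n M × Bs ∈ˡ subsetLists n N)
  disjoint {M} {N} M≢N (∈M , ∈N) =
    M≢N (trans (sym (subsetLists-length M ∈M)) (subsetLists-length N ∈N))

{-# OPTIONS --safe #-}
module Submission where

open import Defs
import Algebra.Properties.Semiring.Sum
open import Data.Bool.Base using (Bool; true; false; if_then_else_)
open import Data.Fin.Base using (Fin; zero; suc)
open import Data.Fin.Properties using (any?) renaming (_≟_ to _≟ᶠ_)
open import Data.Fin.Subset using (Subset; _∈_; _∉_; ∣_∣; Nonempty)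
open import Data.Fin.Subset.Properties using (⊆-antisym; _∈?_; x∈p∩q⁺; x∈p∩q⁻)
open import Data.Integer.Base as ℤ using (ℤ; +_; +[1+_]; -[1+_]; 0ℤ; 1ℤ; -1ℤ; _+_; _-_; _*_; -_; +<+; +≤+)
import Data.Integer.Properties as ℤ
open import Data.Integer.Tactic.RingSolver using (solve-∀)
open import Data.List.Base using (List; []; _∷_; map; filter; length; lookup; upTo; concatMap; cartesianProductWith; tabulate)
open import Data.List.Membership.Propositional using (find; lose) renaming (_∈_ to _∈ˡ_)
open import Data.List.Membership.Propositional.Properties
  using (∈-concatMap⁺; ∈-concatMap⁻; ∈-cartesianProductWith⁺; ∈-cartesianProductWith⁻; ∈-upTo⁺; ∈-upTo⁻; ∈-map⁺; ∈-map⁻; ∈-lookup)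
open import Data.List.Properties using (∷-injective; length-++; length-map; length-upTo; map-cong)
open import Data.List.Relation.Unary.All as All using (All; []; _∷_)
import Data.List.Relation.Unary.All.Properties as All
open import Data.List.Relation.Unary.AllPairs as AllPairs using (AllPairs; []; _∷_)
import Data.List.Relation.Unary.AllPairs.Properties as AllPairs
open import Data.List.Relation.Unary.Any as Any using (Any; here; there)
open import Data.List.Relation.Unary.Any.Properties using (lookup-index)
open import Data.List.Relation.Unary.Unique.Propositional using (Unique)
import Data.List.Relation.Unary.Unique.Propositional.Properties as Unique
open import Data.Nat.Base as ℕ using (ℕ; zero; suc; _≤_; s≤s; z≤n)
open import Data.Nat.GeneralisedArithmetic using (fold)
open import Data.Nat.ListAction using (sum)
import Data.Nat.Properties as ℕ
open import Data.Product.Base using (∃; _×_; _,_; proj₁; proj₂)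
open import Data.Product.Properties using (,-injectiveʳ)
open import Data.Sum.Base using (_⊎_; inj₁; inj₂)
open import Data.Unit.Base using (⊤; tt)
import Data.Vec.Base as Vec
open import Data.Vec.Properties using (lookup∘tabulate; []=⇒lookup; lookup⇒[]=; tabulate-cong)
open import Function.Base using (_∘_)
open import Function.Bundles using (Equivalence)
open import Level using (0ℓ)
open import Relation.Binary.Bundles using (Setoid)
open import Relation.Binary.Definitions using (tri<; tri≈; tri>)
open import Relation.Binary.PropositionalEquality
  using (_≡_; _≢_; refl; sym; trans; cong; cong₂; subst; subst₂; _≗_; module ≡-Reasoning)
open import Relation.Nullary.Decidable using (Dec; yes; no; does; dec-true; dec-false; ¬?; _×-dec_)
open import Relation.Nullary.Negation using (¬_; contradiction)
open import Relation.Unary using (Decidable)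

-- Write sgn (x u - x v) for the flow between u and v, so that firing adds
-- net x v = Σ_u sgn (x u - x v) to x v. The function
--   Σ_{u,v} ∣x u - x v∣ - 2 Σ_v (x v)²
-- grows in one firing by Σ_{u,v} (∣d′∣ + sgn d · d′), where d = x u - x v and d′ is
-- the same difference after the firing. Every summand is nonnegative, so on a
-- periodic orbit all of them vanish: no strict inequality between two stacks
-- survives a firing. Equal stacks stay equal for ever, hence distinct ones stay
-- distinct on a periodic orbit, and each firing reverses the order strictly.
-- Conversely, if the first firing reverses the order, the second one undoes it.
--
-- Firing moves two consecutive levels of sizes b and b′ towards each other by b + b′,
-- so the order is reversed exactly when every gap between consecutive levels is
-- less than b + b′. A class of period configurations is thus an ordered partition
-- with a choice of one of b + b′ - 1 gaps for each pair of consecutive blocks.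

module Σℤ = Algebra.Properties.Semiring.Sum ℤ.+-*-semiring
open Σℤ using () renaming (sum to ∑)

-- Integer inequalities and bounds

i<j⇒0<j-i : ∀ {i j} → i ℤ.< j → 0ℤ ℤ.< j - i
i<j⇒0<j-i {i} {j} i<j = subst (ℤ._< j - i) (ℤ.+-inverseʳ i) (ℤ.+-monoˡ-< (- i) i<j)

i<j⇒i-j<0 : ∀ {i j} → i ℤ.< j → i - j ℤ.< 0ℤ
i<j⇒i-j<0 {i} {j} i<j = subst (i - j ℤ.<_) (ℤ.+-inverseʳ j) (ℤ.+-monoˡ-< (- j) i<j)

+-cancelʳ-< : ∀ {i j} k → i + k ℤ.< j + k → i ℤ.< j
+-cancelʳ-< {i} {j} k i+k<j+k = subst₂ ℤ._<_ (cancel i k) (cancel j k) (ℤ.+-monoˡ-< (- k) i+k<j+k)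
  where
  cancel : ∀ i k → i + k - k ≡ i
  cancel = solve-∀

-- With `<⇒≤-pred`, the descent step of the recursions on height: raising the lower end or lowering
-- the upper end of a range by at least 1 takes 1 off its bound.
≤-shift : ∀ {i j k m} → i ℤ.< j → k ℤ.≤ i + +[1+ m ] → k ℤ.≤ j + + m
≤-shift {i} {j} {k} {m} i<j k≤i+1+m = begin
  k               ≤⟨ k≤i+1+m ⟩
  i + +[1+ m ]    ≡⟨ move i (+ m) ⟩
  1ℤ + i + + m    ≤⟨ ℤ.+-monoˡ-≤ (+ m) (ℤ.i<j⇒suc[i]≤j i<j) ⟩
  j + + m         ∎
  where
  open ℤ.≤-Reasoning
  move : ∀ i m → i + (1ℤ + m) ≡ 1ℤ + i + m
  move = solve-∀

<⇒≤-pred : ∀ {i j k m} → i ℤ.< j → j ℤ.≤ k + +[1+ m ] → i ℤ.≤ k + + m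
<⇒≤-pred {i} {j} {k} {m} i<j j≤k+1+m = ℤ.≮⇒≥ λ k+m<i →
  ℤ.<⇒≱ i<j (ℤ.≤-trans j≤k+1+m (subst (ℤ._≤ i) (move k (+ m)) (ℤ.i<j⇒suc[i]≤j k+m<i)))
  where
  move : ∀ i m → 1ℤ + (i + m) ≡ i + (1ℤ + m)
  move = solve-∀

i≤+∣i∣ : ∀ i → i ℤ.≤ + ℤ.∣ i ∣
i≤+∣i∣ (+ n)    = ℤ.≤-refl
i≤+∣i∣ -[1+ n ] = ℤ.-≤+

-- The witness is the sum of all distances `∣ f i - a ∣`. It is the fuel for the recursions on
-- height in `narrow⇒reversing` and `stacked-exists`.
bounded : ∀ {n} a (f : Fin n → ℤ) → ∃ λ m → ∀ i → f i ℤ.≤ a + + m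
bounded {zero}  a f = 0 , λ ()
bounded {suc n} a f = let m , f≤a+m = bounded a (f ∘ suc) in
  ℤ.∣ f zero - a ∣ ℕ.+ m , λ where
    zero    → ℤ.≤-trans (head≤ (f zero)) (ℤ.+-monoʳ-≤ a (+≤+ (ℕ.m≤m+n _ m)))
    (suc i) → ℤ.≤-trans (f≤a+m i) (ℤ.+-monoʳ-≤ a (+≤+ (ℕ.m≤n+m m _)))
  where
  restore : ∀ a i → a + (i - a) ≡ i
  restore = solve-∀
  head≤ : ∀ i → i ℤ.≤ a + + ℤ.∣ i - a ∣
  head≤ i = subst (ℤ._≤ a + + ℤ.∣ i - a ∣) (restore a i) (ℤ.+-monoʳ-≤ a (i≤+∣i∣ (i - a)))

-- Signs of differences

sgn : ℤ → ℤ
sgn (+ zero)  = 0ℤ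
sgn +[1+ _ ]  = 1ℤ
sgn -[1+ _ ]  = -1ℤ

sgn-pos : ∀ {i} → 0ℤ ℤ.< i → sgn i ≡ 1ℤ
sgn-pos {+[1+ _ ]} _ = refl
sgn-pos {+ zero}   (+<+ ())

sgn-neg : ∀ {i} → i ℤ.< 0ℤ → sgn i ≡ -1ℤ
sgn-neg { -[1+ _ ]} _ = refl
sgn-neg {+ _} (+<+ ())

sgn-> : ∀ {i j} → j ℤ.< i → sgn (i - j) ≡ 1ℤ
sgn-> = sgn-pos ∘ i<j⇒0<j-i

sgn-< : ∀ {i j} → i ℤ.< j → sgn (i - j) ≡ -1ℤ
sgn-< = sgn-neg ∘ i<j⇒i-j<0

sgn-≡ : ∀ {i j} → i ≡ j → sgn (i - j) ≡ 0ℤ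
sgn-≡ i≡j = cong sgn (ℤ.i≡j⇒i-j≡0 i≡j)

sgn-swap : ∀ i j → sgn (i - j) + sgn (j - i) ≡ 0ℤ
sgn-swap i j with ℤ.<-cmp i j
... | tri< i<j _ _ = cong₂ _+_ (sgn-< i<j) (sgn-> i<j)
... | tri≈ _ i≡j _ = cong₂ _+_ (sgn-≡ i≡j) (sgn-≡ (sym i≡j))
... | tri> _ _ j<i = cong₂ _+_ (sgn-> j<i) (sgn-< j<i)

sgn*i≡∣i∣ : ∀ i → sgn i * i ≡ + ℤ.∣ i ∣
sgn*i≡∣i∣ (+ zero)  = refl
sgn*i≡∣i∣ +[1+ n ]  = ℤ.*-identityˡ +[1+ n ]
sgn*i≡∣i∣ -[1+ n ]  = ℤ.-1*i≡-i -[1+ n ]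

∣i∣+i≥0 : ∀ i → 0ℤ ℤ.≤ + ℤ.∣ i ∣ + i
∣i∣+i≥0 (+ n)    = +≤+ z≤n
∣i∣+i≥0 -[1+ n ] = ℤ.≤-reflexive (sym (ℤ.+-inverseʳ +[1+ n ]))

-- The sum is one of `∣i∣`, `∣i∣ + i` and `∣i∣ - i`, whatever `j` is. This makes every summand in
-- the growth of the Lyapunov function nonnegative.
∣i∣+sgn*i≥0 : ∀ i j → 0ℤ ℤ.≤ + ℤ.∣ i ∣ + sgn j * i
∣i∣+sgn*i≥0 i (+ zero) = +≤+ z≤n
∣i∣+sgn*i≥0 i +[1+ _ ] = subst (λ k → 0ℤ ℤ.≤ + ℤ.∣ i ∣ + k) (sym (ℤ.*-identityˡ i)) (∣i∣+i≥0 i)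
∣i∣+sgn*i≥0 i -[1+ _ ] =
  subst₂ (λ m k → 0ℤ ℤ.≤ + m + k) (ℤ.∣-i∣≡∣i∣ i) (sym (ℤ.-1*i≡-i i)) (∣i∣+i≥0 (- i))

∣i∣+i≤0⇒i≤0 : ∀ {i} → + ℤ.∣ i ∣ + i ℤ.≤ 0ℤ → i ℤ.≤ 0ℤ
∣i∣+i≤0⇒i≤0 {+ zero}   _ = ℤ.≤-refl
∣i∣+i≤0⇒i≤0 {+[1+ n ]} (+≤+ ())
∣i∣+i≤0⇒i≤0 { -[1+ n ]} _ = ℤ.-≤+

-- Indicators and finite sums

⟦_⟧ᵇ : Bool → ℤ
⟦ b ⟧ᵇ = if b then 1ℤ else 0ℤ

⟦_⟧ : ∀ {p} {P : Set p} → Dec P → ℤ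
⟦ P? ⟧ = ⟦ does P? ⟧ᵇ

⟦⟧-true : ∀ {p} {P : Set p} (P? : Dec P) → P → ⟦ P? ⟧ ≡ 1ℤ
⟦⟧-true P? p = cong ⟦_⟧ᵇ (dec-true P? p)

⟦⟧-false : ∀ {p} {P : Set p} (P? : Dec P) → ¬ P → ⟦ P? ⟧ ≡ 0ℤ
⟦⟧-false P? ¬p = cong ⟦_⟧ᵇ (dec-false P? ¬p)

-- Stated for `tabulate f` so that the induction can pass to `f ∘ suc`; `allFin` is the case where
-- `f` is the identity.
length-filter-tabulate : ∀ {a p} {A : Set a} {P : A → Set p} (P? : Decidable P) {n} (f : Fin n → A) →
  + length (filter P? (tabulate f)) ≡ ∑ (λ i → ⟦ P? (f i) ⟧)
length-filter-tabulate P? {zero}  f = refl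
length-filter-tabulate P? {suc n} f with does (P? (f zero))
... | true  = cong (_+_ 1ℤ) (length-filter-tabulate P? (f ∘ suc))
... | false = trans (length-filter-tabulate P? (f ∘ suc)) (sym (ℤ.+-identityˡ _))

card-tabulate : ∀ {n} (f : Fin n → Bool) → + ∣ Vec.tabulate f ∣ ≡ ∑ (λ i → ⟦ f i ⟧ᵇ)
card-tabulate {zero}  f = refl
card-tabulate {suc n} f with f zero
... | true  = cong (_+_ 1ℤ) (card-tabulate (f ∘ suc))
... | false = trans (card-tabulate (f ∘ suc)) (sym (ℤ.+-identityˡ _))

∑-nonneg : ∀ {n} (f : Fin n → ℤ) → (∀ i → 0ℤ ℤ.≤ f i) → 0ℤ ℤ.≤ ∑ f
∑-nonneg {zero}  f f≥0 = ℤ.≤-refl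
∑-nonneg {suc n} f f≥0 = ℤ.+-mono-≤ (f≥0 zero) (∑-nonneg (f ∘ suc) (f≥0 ∘ suc))

term≤∑ : ∀ {n} (f : Fin n → ℤ) → (∀ i → 0ℤ ℤ.≤ f i) → ∀ i → f i ℤ.≤ ∑ f
term≤∑ f f≥0 zero    = subst (ℤ._≤ ∑ f) (ℤ.+-identityʳ _) (ℤ.+-monoʳ-≤ (f zero) (∑-nonneg (f ∘ suc) (f≥0 ∘ suc)))
term≤∑ f f≥0 (suc i) = subst (ℤ._≤ ∑ f) (ℤ.+-identityˡ _) (ℤ.+-mono-≤ (f≥0 zero) (term≤∑ (f ∘ suc) (f≥0 ∘ suc) i))

∑∑-cong : ∀ {m n} {f g : Fin m → Fin n → ℤ} → (∀ i j → f i j ≡ g i j) → ∑ (λ i → ∑ (f i)) ≡ ∑ (λ i → ∑ (g i))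
∑∑-cong f≗g = Σℤ.sum-cong-≗ (λ i → Σℤ.sum-cong-≗ (f≗g i))

∑∑-distrib-+ : ∀ {m n} (f g : Fin m → Fin n → ℤ) →
  ∑ (λ i → ∑ (λ j → f i j + g i j)) ≡ ∑ (λ i → ∑ (f i)) + ∑ (λ i → ∑ (g i))
∑∑-distrib-+ f g = trans (Σℤ.sum-cong-≗ (λ i → Σℤ.∑-distrib-+ (f i) (g i))) (Σℤ.∑-distrib-+ (∑ ∘ f) (∑ ∘ g))

-- Positive gaps and least values

i<i+1+n : ∀ i n → i ℤ.< i + +[1+ n ]
i<i+1+n i n = subst (ℤ._< i + +[1+ n ]) (ℤ.+-identityʳ i) (ℤ.+-monoʳ-< i (+<+ (s≤s z≤n)))

<⇒gap : ∀ {i j} → i ℤ.< j → ∃ λ g → j ≡ i + +[1+ g ]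
<⇒gap {i} {j} i<j = let g , j-i≡1+g = positive (i<j⇒0<j-i i<j) in
  g , trans (sym (restore i j)) (cong (_+_ i) j-i≡1+g)
  where
  restore : ∀ i j → i + (j - i) ≡ j
  restore = solve-∀
  positive : ∀ {k} → 0ℤ ℤ.< k → ∃ λ g → k ≡ +[1+ g ]
  positive {+[1+ g ]} _ = g , refl
  positive {+ zero}   (+<+ ())

gap-injective : ∀ i {g h} → i + +[1+ g ] ≡ i + +[1+ h ] → g ≡ h
gap-injective i {g} {h} eq = ℤ.+[1+-injective
  (trans (sym (cancel i +[1+ g ])) (trans (cong (λ k → k - i) eq) (cancel i +[1+ h ])))
  where
  cancel : ∀ i k → i + k - i ≡ k
  cancel = solve-∀

+-cancelˡ-<-pos : ∀ i {m n} → i + + m ℤ.< i + + n → m ℕ.< n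
+-cancelˡ-<-pos i {m} {n} lt =
  ℤ.drop‿+<+ (+-cancelʳ-< i (subst₂ ℤ._<_ (ℤ.+-comm i (+ m)) (ℤ.+-comm i (+ n)) lt))

-- An entry `g` encodes the gap `suc g`. This and `<-pred⁻` translate between the bound
-- `suc g < b + b′` on the gap and membership of `g` in `upTo (b + b′ ∸ 1)`.
<-pred⁺ : ∀ {m n} → suc m ℕ.< n → m ℕ.< n ℕ.∸ 1
<-pred⁺ (s≤s 1+m≤n) = 1+m≤n

<-pred⁻ : ∀ {m n} → m ℕ.< n ℕ.∸ 1 → suc m ℕ.< n
<-pred⁻ {n = suc n} m<n = s≤s m<n

-- Finds the next level above a given one and, with the trivial predicate, the lowest stack.
least : ∀ {n} {P : Fin n → Set} (P? : Decidable P) (f : Fin n → ℤ) →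
  (∀ i → ¬ P i) ⊎ ∃ λ i → P i × (∀ j → P j → f i ℤ.≤ f j)
least {zero}  P? f = inj₁ λ ()
least {suc n} P? f with P? zero | least (P? ∘ suc) (f ∘ suc)
... | no ¬p | inj₁ none          = inj₁ λ where
  zero    → ¬p
  (suc i) → none i
... | no ¬p | inj₂ (i , p , min) = inj₂ (suc i , p , λ where
  zero    q → contradiction q ¬p
  (suc j) q → min j q)
... | yes p | inj₁ none          = inj₂ (zero , p , λ where
  zero    q → ℤ.≤-refl
  (suc j) q → contradiction q (none j))
... | yes p | inj₂ (i , q , min) with ℤ.≤-total (f zero) (f (suc i))
...   | inj₁ 0≤i = inj₂ (zero , p , λ where
  zero    _ → ℤ.≤-refl
  (suc j) r → ℤ.≤-trans 0≤i (min j r))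
...   | inj₂ i≤0 = inj₂ (suc i , q , λ where
  zero    _ → i≤0
  (suc j) r → min j r)

-- Lengths of lists and cardinality by enumeration

length-cartesianProductWith : ∀ {a b c} {A : Set a} {B : Set b} {C : Set c} (f : A → B → C) xs ys →
  length (cartesianProductWith f xs ys) ≡ length xs ℕ.* length ys
length-cartesianProductWith f []       ys = refl
length-cartesianProductWith f (x ∷ xs) ys = trans (length-++ (map (f x) ys))
  (cong₂ ℕ._+_ (length-map (f x) ys) (length-cartesianProductWith f xs ys))

length-concatMap : ∀ {a b} {A : Set a} {B : Set b} (f : A → List B) xs →
  length (concatMap f xs) ≡ sum (map (length ∘ f) xs)
length-concatMap f []       = refl
length-concatMap f (x ∷ xs) = trans (length-++ (f x)) (cong (ℕ._+_ (length (f x))) (length-concatMap f xs))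

lookup-injective : ∀ {a} {A : Set a} {xs : List A} → Unique xs → ∀ i j → lookup xs i ≡ lookup xs j → i ≡ j
lookup-injective (x∉xs ∷ _) zero    zero    _  = refl
lookup-injective (x∉xs ∷ _) zero    (suc j) eq = contradiction eq (All.lookup x∉xs (∈-lookup j))
lookup-injective (x∉xs ∷ _) (suc i) zero    eq = contradiction (sym eq) (All.lookup x∉xs (∈-lookup i))
lookup-injective (_ ∷ uniq) (suc i) (suc j) eq = cong suc (lookup-injective uniq i j eq)

-- `f` receives the membership proof because periodicity of a coded configuration is derived from
-- it. Surjectivity is asked for every membership proof, since the bijection evaluates `f` at the
-- particular proof `∈-lookup i`.
enumeration⇒HasCardinality : ∀ (S : Setoid 0ℓ 0ℓ) → let open Setoid S in
  ∀ {A : Set} {xs : List A} → Unique xs →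
  (f : ∀ {x} → x ∈ˡ xs → Carrier) →
  (∀ {x y} (x∈ : x ∈ˡ xs) (y∈ : y ∈ˡ xs) → f x∈ ≈ f y∈ → x ≡ y) →
  (∀ s → ∃ λ x → x ∈ˡ xs × (∀ (x∈ : x ∈ˡ xs) → f x∈ ≈ s)) →
  HasCardinality S (length xs)
enumeration⇒HasCardinality S {xs = xs} uniq f f-injective f-surjective = record
  { to        = λ i → f (∈-lookup i)
  ; cong      = λ { refl → Setoid.refl S }
  ; bijective = (λ {i} {j} eq → lookup-injective uniq i j (f-injective (∈-lookup i) (∈-lookup j) eq))
              , surjective
  }
  where
  at : ∀ {x y s} → x ≡ y → (∀ (x∈ : x ∈ˡ xs) → Setoid._≈_ S (f x∈) s) → ∀ (y∈ : y ∈ˡ xs) → Setoid._≈_ S (f y∈) s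
  at refl f≈s = f≈s
  surjective : ∀ s → ∃ λ i → ∀ {j} → j ≡ i → Setoid._≈_ S (f (∈-lookup {xs = xs} j)) s
  surjective s = let x , x∈ , f≈s = f-surjective s in
    Any.index x∈ , λ { refl → at (lookup-index x∈) f≈s (∈-lookup (Any.index x∈)) }

-- Codes: an ordered partition with a list of gaps

-- An entry g stands for the gap suc g.
gapLists : ∀ {n} → List (Subset n) → List (List ℕ)
gapLists []           = [] ∷ []
gapLists (B ∷ [])     = [] ∷ []
gapLists (B ∷ C ∷ Bs) = cartesianProductWith _∷_ (upTo (∣ B ∣ ℕ.+ ∣ C ∣ ℕ.∸ 1)) (gapLists (C ∷ Bs))

length-gapLists : ∀ {n} (Bs : List (Subset n)) → length (gapLists Bs) ≡ blockProduct Bs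
length-gapLists []           = refl
length-gapLists (B ∷ [])     = refl
length-gapLists (B ∷ C ∷ Bs) = trans (length-cartesianProductWith _∷_ (upTo (∣ B ∣ ℕ.+ ∣ C ∣ ℕ.∸ 1)) (gapLists (C ∷ Bs)))
  (cong₂ ℕ._*_ (length-upTo (∣ B ∣ ℕ.+ ∣ C ∣ ℕ.∸ 1)) (length-gapLists (C ∷ Bs)))

gapLists-unique : ∀ {n} (Bs : List (Subset n)) → Unique (gapLists Bs)
gapLists-unique []           = [] ∷ []
gapLists-unique (B ∷ [])     = [] ∷ []
gapLists-unique (B ∷ C ∷ Bs) = Unique.cartesianProductWith⁺ _∷_ ∷-injective
  (Unique.upTo⁺ (∣ B ∣ ℕ.+ ∣ C ∣ ℕ.∸ 1)) (gapLists-unique (C ∷ Bs))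

Code : ℕ → Set
Code n = List (Subset n) × List ℕ

codes : ∀ n → List (Code n)
codes n = concatMap (λ Bs → map (Bs ,_) (gapLists Bs)) (orderedPartitions n)

length-codes : ∀ n → length (codes n) ≡ sum (map blockProduct (orderedPartitions n))
length-codes n = trans (length-concatMap (λ Bs → map (Bs ,_) (gapLists Bs)) (orderedPartitions n))
  (cong sum (map-cong (λ Bs → trans (length-map (Bs ,_) (gapLists Bs)) (length-gapLists Bs)) (orderedPartitions n)))

codes-unique : ∀ n → Unique (codes n)
codes-unique n = Unique.concat⁺
  (All.map⁺ (All.universal (λ Bs → Unique.map⁺ ,-injectiveʳ (gapLists-unique Bs)) (orderedPartitions n)))
  (AllPairs.map⁺ (AllPairs.map (λ Bs≢Cs {x} → disjoint Bs≢Cs {x}) (orderedPartitions-unique n)))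
  where
  disjoint : ∀ {Bs Cs} → Bs ≢ Cs → ∀ {x} → ¬ (x ∈ˡ map (Bs ,_) (gapLists Bs) × x ∈ˡ map (Cs ,_) (gapLists Cs))
  disjoint Bs≢Cs (∈Bs , ∈Cs) with ∈-map⁻ _ ∈Bs | ∈-map⁻ _ ∈Cs
  ... | _ , _ , refl | _ , _ , eq = Bs≢Cs (cong proj₁ eq)

∈-codes⁺ : ∀ {n Bs gs} → IsOrderedPartition {n} Bs → gs ∈ˡ gapLists Bs → (Bs , gs) ∈ˡ codes n
∈-codes⁺ {Bs = Bs} part gs∈ = ∈-concatMap⁺ (λ Bs → map (Bs ,_) (gapLists Bs))
  (lose (Equivalence.from (∈-orderedPartitions Bs) part) (∈-map⁺ (Bs ,_) gs∈))

∈-codes⁻ : ∀ {n Bs gs} → (Bs , gs) ∈ˡ codes n → IsOrderedPartition Bs × gs ∈ˡ gapLists Bs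
∈-codes⁻ {n} x∈ with find (∈-concatMap⁻ (λ Bs → map (Bs ,_) (gapLists Bs)) {xs = orderedPartitions n} x∈)
... | Bs , Bs∈ , x∈Bs with ∈-map⁻ (Bs ,_) x∈Bs
...   | gs , gs∈ , refl = Equivalence.to (∈-orderedPartitions Bs) Bs∈ , gs∈

-- The catch-all clause is the top block; elements of no block also get a height.
height : ∀ {n} → List (Subset n) → List ℕ → Fin n → ℕ
height (B ∷ Bs) (g ∷ gs) v = if does (v ∈? B) then 0 else suc g ℕ.+ height Bs gs v
height _        _        v = 0

height-∈ : ∀ {n} {B : Subset n} {Bs g gs v} → v ∈ B → height (B ∷ Bs) (g ∷ gs) v ≡ 0
height-∈ {B = B} {Bs} {g} {gs} {v} v∈B =
  cong (λ b → if b then 0 else suc g ℕ.+ height Bs gs v) (dec-true (v ∈? B) v∈B)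

height-∉ : ∀ {n} {B : Subset n} {Bs g gs v} → v ∉ B → height (B ∷ Bs) (g ∷ gs) v ≡ suc g ℕ.+ height Bs gs v
height-∉ {B = B} {Bs} {g} {gs} {v} v∉B =
  cong (λ b → if b then 0 else suc g ℕ.+ height Bs gs v) (dec-false (v ∈? B) v∉B)

-- For an ordered partition the lowest block sits at 0, which normalises the choice of
-- representative within a class.
config : ∀ {n} → List (Subset n) → List ℕ → Configuration n
config Bs gs v = + height Bs gs v

module _ {n : ℕ} where
  open ParallelDiffusion (complete n)

  -- Firing as a sum of signs

  net : Configuration n → Configuration n
  net c v = ∑ (λ u → sgn (c u - c v))

  -- The sign of `c u - c v` is the richer indicator minus the poorer one. Distinct stacks force
  -- distinct vertices, hence adjacency in the complete graph, and `v` itself contributes sign 0.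
  fire≡c+net : ∀ c v → fire c v ≡ c v + net c v
  fire≡c+net c v = trans (cong (λ r → c v + r - + #poorer c v) richer≡) (cancel (c v) (+ #poorer c v) (net c v))
    where
    cancel : ∀ i p k → i + (p + k) - p ≡ i + k
    cancel = solve-∀
    richer? : ∀ u → Dec (v ≢ u × c v ℤ.< c u)
    richer? u = ¬? (v ≟ᶠ u) ×-dec (c v ℤ.<? c u)
    poorer? : ∀ u → Dec (v ≢ u × c u ℤ.< c v)
    poorer? u = ¬? (v ≟ᶠ u) ×-dec (c u ℤ.<? c v)
    pointwise : ∀ u → ⟦ richer? u ⟧ ≡ ⟦ poorer? u ⟧ + sgn (c u - c v)
    pointwise u with ℤ.<-cmp (c v) (c u)
    ... | tri< v<u v≢u v≯u = trans (⟦⟧-true (richer? u) ((λ v≡u → v≢u (cong c v≡u)) , v<u))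
      (sym (cong₂ _+_ (⟦⟧-false (poorer? u) (v≯u ∘ proj₂)) (sgn-> v<u)))
    ... | tri≈ v≮u v≡u v≯u = trans (⟦⟧-false (richer? u) (v≮u ∘ proj₂))
      (sym (cong₂ _+_ (⟦⟧-false (poorer? u) (v≯u ∘ proj₂)) (sgn-≡ (sym v≡u))))
    ... | tri> v≮u v≢u v>u = trans (⟦⟧-false (richer? u) (v≮u ∘ proj₂))
      (sym (cong₂ _+_ (⟦⟧-true (poorer? u) ((λ v≡u → v≢u (cong c v≡u)) , v>u)) (sgn-< v>u)))
    richer≡ : + #richer c v ≡ + #poorer c v + net c v
    richer≡ = begin
      + #richer c v                                  ≡⟨ length-filter-tabulate richer? (λ u → u) ⟩
      ∑ (λ u → ⟦ richer? u ⟧)                        ≡⟨ Σℤ.sum-cong-≗ pointwise ⟩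
      ∑ (λ u → ⟦ poorer? u ⟧ + sgn (c u - c v))      ≡⟨ Σℤ.∑-distrib-+ _ (λ u → sgn (c u - c v)) ⟩
      ∑ (λ u → ⟦ poorer? u ⟧) + net c v              ≡⟨ cong (_+ net c v) (sym (length-filter-tabulate poorer? (λ u → u))) ⟩
      + #poorer c v + net c v                        ∎
      where open ≡-Reasoning

  -- The sum runs over all vertices, so `net c v` depends on `v` only through `c v`.
  net-cong-at : ∀ c {u v} → c u ≡ c v → net c u ≡ net c v
  net-cong-at c u≡v = cong (λ i → ∑ (λ w → sgn (c w - i))) u≡v

  fire-cong-at : ∀ c {u v} → c u ≡ c v → fire c u ≡ fire c v
  fire-cong-at c {u} {v} u≡v =
    trans (fire≡c+net c u) (trans (cong₂ _+_ u≡v (net-cong-at c u≡v)) (sym (fire≡c+net c v)))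

  fold-fire-cong-at : ∀ c k {u v} → c u ≡ c v → fold c fire k u ≡ fold c fire k v
  fold-fire-cong-at c zero    u≡v = u≡v
  fold-fire-cong-at c (suc k) u≡v = fire-cong-at (fold c fire k) (fold-fire-cong-at c k u≡v)

  -- Periodic configurations reverse their order

  spread : Configuration n → ℤ
  spread c = ∑ (λ u → ∑ (λ v → + ℤ.∣ c u - c v ∣))

  energy : Configuration n → ℤ
  energy c = ∑ (λ v → c v * c v)

  work : Configuration n → Configuration n → ℤ
  work c x = ∑ (λ v → net c v * x v)

  -- Signs are taken from `c`, differences from `x`. At `x = c` this is `spread c`; at `x = fire c`
  -- it is the sum of the second terms of `slack`.
  signedSpread : Configuration n → Configuration n → ℤ
  signedSpread c x = ∑ (λ u → ∑ (λ v → sgn (c u - c v) * (x u - x v)))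

  -- Summation by parts: the flow is antisymmetric, so each end of a pair contributes `- work c x`
  -- in total. Writing one copy of `work` by rows and the other by columns makes the sum vanish term
  -- by term.
  signedSpread-work : ∀ c x → signedSpread c x + (work c x + work c x) ≡ 0ℤ
  signedSpread-work c x = begin
    signedSpread c x + (work c x + work c x)
      ≡⟨ cong (λ k → signedSpread c x + k) (cong₂ _+_ rows columns) ⟩
    signedSpread c x + (∑ (λ u → ∑ (λ v → s v u * x u)) + ∑ (λ u → ∑ (λ v → s u v * x v)))
      ≡⟨ cong (_+_ (signedSpread c x)) (sym (∑∑-distrib-+ (λ u v → s v u * x u) (λ u v → s u v * x v))) ⟩
    signedSpread c x + ∑ (λ u → ∑ (λ v → s v u * x u + s u v * x v))
      ≡⟨ sym (∑∑-distrib-+ (λ u v → s u v * (x u - x v)) (λ u v → s v u * x u + s u v * x v)) ⟩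
    ∑ (λ u → ∑ (λ v → s u v * (x u - x v) + (s v u * x u + s u v * x v)))
      ≡⟨ ∑∑-cong (λ u v → trans (factor (s u v) (s v u) (x u) (x v))
           (trans (cong (_* x u) (sgn-swap (c u) (c v))) (ℤ.*-zeroˡ (x u)))) ⟩
    ∑ {n} (λ u → ∑ {n} (λ v → 0ℤ))
      ≡⟨ Σℤ.sum-cong-≗ {n} (λ _ → Σℤ.sum-replicate-zero n) ⟩
    ∑ {n} (λ u → 0ℤ)
      ≡⟨ Σℤ.sum-replicate-zero n ⟩
    0ℤ ∎
    where
    open ≡-Reasoning
    s : Fin n → Fin n → ℤ
    s u v = sgn (c u - c v)
    factor : ∀ p q i j → p * (i - j) + (q * i + p * j) ≡ (p + q) * i
    factor = solve-∀
    rows : work c x ≡ ∑ (λ u → ∑ (λ v → s v u * x u))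
    rows = Σℤ.sum-cong-≗ (λ u → Σℤ.*-distribʳ-sum (x u) (λ v → s v u))
    columns : work c x ≡ ∑ (λ u → ∑ (λ v → s u v * x v))
    columns = trans rows (Σℤ.∑-comm (λ u v → s v u * x u))

  spread-work : ∀ c → spread c + (work c c + work c c) ≡ 0ℤ
  spread-work c = trans
    (cong (_+ (work c c + work c c)) (sym (∑∑-cong (λ u v → sgn*i≡∣i∣ (c u - c v)))))
    (signedSpread-work c c)

  -- The square `(i + f)²` is expanded as `i² + f * i + f * (i + f)`, so that the increment consists
  -- of two pairings with `net c`, one with the old and one with the new configuration, and
  -- `signedSpread-work` applies to both.
  energy-fire : ∀ c → energy (fire c) ≡ energy c + (work c c + work c (fire c))
  energy-fire c = begin
    energy (fire c)
      ≡⟨ Σℤ.sum-cong-≗ (λ v → square (c v) (net c v) (fire c v) (fire≡c+net c v)) ⟩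
    ∑ (λ v → c v * c v + (net c v * c v + net c v * fire c v))
      ≡⟨ Σℤ.∑-distrib-+ (λ v → c v * c v) (λ v → net c v * c v + net c v * fire c v) ⟩
    energy c + ∑ (λ v → net c v * c v + net c v * fire c v)
      ≡⟨ cong (_+_ (energy c)) (Σℤ.∑-distrib-+ (λ v → net c v * c v) (λ v → net c v * fire c v)) ⟩
    energy c + (work c c + work c (fire c)) ∎
    where
    open ≡-Reasoning
    expand : ∀ i f → (i + f) * (i + f) ≡ i * i + (f * i + f * (i + f))
    expand = solve-∀
    square : ∀ i f k → k ≡ i + f → k * k ≡ i * i + (f * i + f * k)
    square i f _ refl = expand i f

  lyapunov : Configuration n → ℤ
  lyapunov c = spread c - (energy c + energy c)

  slack : Configuration n → Fin n → Fin n → ℤ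
  slack c u v = + ℤ.∣ fire c u - fire c v ∣ + sgn (c u - c v) * (fire c u - fire c v)

  slack≥0 : ∀ c u v → 0ℤ ℤ.≤ slack c u v
  slack≥0 c u v = ∣i∣+sgn*i≥0 (fire c u - fire c v) (c u - c v)

  ∑slack≥0 : ∀ c u → 0ℤ ℤ.≤ ∑ (slack c u)
  ∑slack≥0 c u = ∑-nonneg (slack c u) (slack≥0 c u)

  -- Twice the energy increment is `- spread c - signedSpread c (fire c)`. Subtracting it restores
  -- `spread c` and leaves `spread (fire c) + signedSpread c (fire c)` as growth. `regroup` isolates
  -- the two brackets that vanish by summation by parts.
  lyapunov-fire : ∀ c → lyapunov (fire c) ≡ lyapunov c + ∑ (λ u → ∑ (slack c u))
  lyapunov-fire c = begin
    spread (fire c) - (energy (fire c) + energy (fire c))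
      ≡⟨ cong (λ e → spread (fire c) - (e + e)) (energy-fire c) ⟩
    spread (fire c) - (energy c + (work c c + work c (fire c)) + (energy c + (work c c + work c (fire c))))
      ≡⟨ regroup (spread (fire c)) (spread c) (signedSpread c (fire c)) (energy c) (work c c) (work c (fire c)) ⟩
    lyapunov c + (spread (fire c) + signedSpread c (fire c))
      - (spread c + (work c c + work c c))
      - (signedSpread c (fire c) + (work c (fire c) + work c (fire c)))
      ≡⟨ cong₂ (λ i j → lyapunov c + (spread (fire c) + signedSpread c (fire c)) - i - j)
           (spread-work c) (signedSpread-work c (fire c)) ⟩
    lyapunov c + (spread (fire c) + signedSpread c (fire c)) - 0ℤ - 0ℤ
      ≡⟨ trans (ℤ.+-identityʳ _) (ℤ.+-identityʳ _) ⟩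
    lyapunov c + (spread (fire c) + signedSpread c (fire c))
      ≡⟨ cong (_+_ (lyapunov c)) (sym (∑∑-distrib-+ (λ u v → + ℤ.∣ fire c u - fire c v ∣)
           (λ u v → sgn (c u - c v) * (fire c u - fire c v)))) ⟩
    lyapunov c + ∑ (λ u → ∑ (slack c u)) ∎
    where
    open ≡-Reasoning
    regroup : ∀ s′ s k e w w′ →
      s′ - (e + (w + w′) + (e + (w + w′))) ≡ s - (e + e) + (s′ + k) - (s + (w + w)) - (k + (w′ + w′))
    regroup = solve-∀

  lyapunov-mono : ∀ c → lyapunov c ℤ.≤ lyapunov (fire c)
  lyapunov-mono c = subst₂ ℤ._≤_ (ℤ.+-identityʳ _) (sym (lyapunov-fire c))
    (ℤ.+-monoʳ-≤ (lyapunov c) (∑-nonneg _ (∑slack≥0 c)))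

  lyapunov-fold : ∀ c k → lyapunov (fire c) ℤ.≤ lyapunov (fold c fire (suc k))
  lyapunov-fold c zero    = ℤ.≤-refl
  lyapunov-fold c (suc k) = ℤ.≤-trans (lyapunov-fold c k) (lyapunov-mono (fold c fire (suc k)))

  lyapunov-cong : ∀ {c d} → c ≗ d → lyapunov c ≡ lyapunov d
  lyapunov-cong c≗d = cong₂ (λ s e → s - (e + e))
    (∑∑-cong (λ u v → cong₂ (λ i j → + ℤ.∣ i - j ∣) (c≗d u) (c≗d v)))
    (Σℤ.sum-cong-≗ (λ v → cong₂ _*_ (c≗d v) (c≗d v)))

  Reversing : Configuration n → Set
  Reversing c = ∀ u v → c u ℤ.< c v → fire c v ℤ.< fire c u

  -- The growth of the first firing is the sum of all slacks. Later firings never decrease the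
  -- function and the orbit returns to `c`, so this growth is at most 0, and each nonnegative
  -- summand is bounded by it.
  period⇒slack≤0 : ∀ {c} → IsPeriod c → ∀ u v → slack c u v ℤ.≤ 0ℤ
  period⇒slack≤0 {c} (suc k , _ , fold≗c) u v = begin
    slack c u v                      ≤⟨ term≤∑ (slack c u) (slack≥0 c u) v ⟩
    ∑ (slack c u)                    ≤⟨ term≤∑ (λ w → ∑ (slack c w)) (∑slack≥0 c) u ⟩
    ∑ (λ w → ∑ (slack c w))          ≡⟨ cancel (lyapunov c) _ ⟩
    lyapunov c + ∑ (λ w → ∑ (slack c w)) - lyapunov c
                                     ≡⟨ cong (_- lyapunov c) (sym (lyapunov-fire c)) ⟩
    lyapunov (fire c) - lyapunov c   ≤⟨ ℤ.i≤j⇒i-j≤0 (subst (lyapunov (fire c) ℤ.≤_) (lyapunov-cong fold≗c) (lyapunov-fold c k)) ⟩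
    0ℤ                               ∎
    where
    open ℤ.≤-Reasoning
    cancel : ∀ l k → k ≡ l + k - l
    cancel = solve-∀

  period⇒reversing : ∀ {c} → IsPeriod c → Reversing c
  period⇒reversing {c} period@(suc k , _ , fold≗c) u v u<v = ℤ.≤∧≢⇒< v≤u v≢u
    where
    v≤u : fire c v ℤ.≤ fire c u
    -- The pair is taken as `v`, `u`, where the sign is 1 and the slack has the form `∣i∣ + i`.
    v≤u = ℤ.i-j≤0⇒i≤j (∣i∣+i≤0⇒i≤0 (subst (λ k → + ℤ.∣ fire c v - fire c u ∣ + k ℤ.≤ 0ℤ)
      (trans (cong (_* (fire c v - fire c u)) (sgn-> u<v)) (ℤ.*-identityˡ _))
      (period⇒slack≤0 period v u)))
    fold-fire : ∀ j → fold c fire (suc j) ≡ fold (fire c) fire j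
    fold-fire zero    = refl
    fold-fire (suc j) = cong fire (fold-fire j)
    -- Stacks merged by the first firing would still be equal when the orbit returns to `c`.
    v≢u : fire c v ≢ fire c u
    v≢u v≡u = ℤ.<-irrefl (begin
      c u                       ≡⟨ sym (fold≗c u) ⟩
      fold c fire (suc k) u     ≡⟨ cong (λ d → d u) (fold-fire k) ⟩
      fold (fire c) fire k u    ≡⟨ fold-fire-cong-at (fire c) k (sym v≡u) ⟩
      fold (fire c) fire k v    ≡⟨ cong (λ d → d v) (sym (fold-fire k)) ⟩
      fold c fire (suc k) v     ≡⟨ fold≗c v ⟩
      c v                       ∎) u<v
      where open ≡-Reasoning

  -- Reversal negates every nonzero sign and ties persist, so the second firing has the opposite
  -- `net` and two firings restore `c`.
  reversing⇒period : ∀ {c} → Reversing c → IsPeriod c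
  reversing⇒period {c} rev = 2 , s≤s z≤n , λ v → begin
    fire (fire c) v                           ≡⟨ fire≡c+net (fire c) v ⟩
    fire c v + net (fire c) v                 ≡⟨ cong (_+ net (fire c) v) (fire≡c+net c v) ⟩
    c v + net c v + net (fire c) v            ≡⟨ ℤ.+-assoc (c v) _ _ ⟩
    c v + (net c v + net (fire c) v)          ≡⟨ cong (_+_ (c v)) (opposite v) ⟩
    c v + 0ℤ                                  ≡⟨ ℤ.+-identityʳ (c v) ⟩
    c v                                       ∎
    where
    open ≡-Reasoning
    pointwise : ∀ u v → sgn (c u - c v) + sgn (fire c u - fire c v) ≡ 0ℤ
    pointwise u v with ℤ.<-cmp (c u) (c v)
    ... | tri< u<v _ _ = cong₂ _+_ (sgn-< u<v) (sgn-> (rev u v u<v))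
    ... | tri≈ _ u≡v _ = cong₂ _+_ (sgn-≡ u≡v) (sgn-≡ (fire-cong-at c u≡v))
    ... | tri> _ _ v<u = cong₂ _+_ (sgn-> v<u) (sgn-< (rev v u v<u))
    opposite : ∀ v → net c v + net (fire c) v ≡ 0ℤ
    opposite v = trans (sym (Σℤ.∑-distrib-+ (λ u → sgn (c u - c v)) (λ u → sgn (fire c u - fire c v))))
      (trans (Σℤ.sum-cong-≗ (λ u → pointwise u v)) (Σℤ.sum-replicate-zero n))

  -- Gaps between consecutive levels

  level : Configuration n → ℤ → Subset n
  level c a = Vec.tabulate (λ v → does (c v ℤ.≟ a))

  ∈-level⁺ : ∀ c {a v} → c v ≡ a → v ∈ level c a
  ∈-level⁺ c {a} {v} v≡a = lookup⇒[]= v (level c a)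
    (trans (lookup∘tabulate _ v) (dec-true (c v ℤ.≟ a) v≡a))

  ∈-level⁻ : ∀ c {a v} → v ∈ level c a → c v ≡ a
  ∈-level⁻ c {a} {v} v∈ with c v ℤ.≟ a | trans (sym (lookup∘tabulate (λ v → does (c v ℤ.≟ a)) v)) ([]=⇒lookup v∈)
  ... | yes v≡a | _ = v≡a
  ... | no  _   | ()

  ≡-level : ∀ {c a B} → (∀ {v} → v ∈ B → c v ≡ a) → (∀ {v} → c v ≡ a → v ∈ B) → B ≡ level c a
  ≡-level {c} B⇒a a⇒B = ⊆-antisym (∈-level⁺ c ∘ B⇒a) (a⇒B ∘ ∈-level⁻ c)

  Adjacent : Configuration n → Fin n → Fin n → Set
  Adjacent c u v = c u ℤ.< c v × (∀ w → c u ℤ.< c w → c v ℤ.≤ c w)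

  levels : Configuration n → Fin n → Fin n → ℕ
  levels c u v = ∣ level c (c u) ∣ ℕ.+ ∣ level c (c v) ∣

  Narrow : Configuration n → Set
  Narrow c = ∀ u v → Adjacent c u v → c v ℤ.< c u + + levels c u v

  -- Moving the viewpoint from `v` down to `u` raises the sign by 1 exactly for the vertices of the
  -- two levels: from -1 to 0 on the level of `u`, from 0 to 1 on that of `v`. Adjacency excludes
  -- vertices in between.
  net-adjacent : ∀ c {u v} → Adjacent c u v → net c u ≡ net c v + + levels c u v
  net-adjacent c {u} {v} (u<v , least) = begin
    net c u
      ≡⟨ Σℤ.sum-cong-≗ pointwise ⟩
    ∑ (λ w → sgn (c w - c v) + (⟦ c w ℤ.≟ c u ⟧ + ⟦ c w ℤ.≟ c v ⟧))
      ≡⟨ Σℤ.∑-distrib-+ (λ w → sgn (c w - c v)) (λ w → ⟦ c w ℤ.≟ c u ⟧ + ⟦ c w ℤ.≟ c v ⟧) ⟩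
    net c v + ∑ (λ w → ⟦ c w ℤ.≟ c u ⟧ + ⟦ c w ℤ.≟ c v ⟧)
      ≡⟨ cong (_+_ (net c v)) (Σℤ.∑-distrib-+ (λ w → ⟦ c w ℤ.≟ c u ⟧) (λ w → ⟦ c w ℤ.≟ c v ⟧)) ⟩
    net c v + (∑ (λ w → ⟦ c w ℤ.≟ c u ⟧) + ∑ (λ w → ⟦ c w ℤ.≟ c v ⟧))
      ≡⟨ cong (_+_ (net c v)) (sym (cong₂ _+_ (card-tabulate (λ w → does (c w ℤ.≟ c u))) (card-tabulate (λ w → does (c w ℤ.≟ c v))))) ⟩
    net c v + + levels c u v ∎
    where
    open ≡-Reasoning
    pointwise : ∀ w → sgn (c w - c u) ≡ sgn (c w - c v) + (⟦ c w ℤ.≟ c u ⟧ + ⟦ c w ℤ.≟ c v ⟧)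
    pointwise w with ℤ.<-cmp (c w) (c u) | ℤ.<-cmp (c w) (c v)
    ... | tri< w<u w≢u _ | _ = trans (sgn-< w<u) (sym (cong₂ _+_ (sgn-< w<v)
      (cong₂ _+_ (⟦⟧-false (c w ℤ.≟ c u) w≢u) (⟦⟧-false (c w ℤ.≟ c v) (ℤ.<⇒≢ w<v)))))
      where w<v = ℤ.<-trans w<u u<v
    ... | tri≈ _ w≡u _ | _ = trans (sgn-≡ w≡u) (sym (cong₂ _+_ (sgn-< w<v)
      (cong₂ _+_ (⟦⟧-true (c w ℤ.≟ c u) w≡u) (⟦⟧-false (c w ℤ.≟ c v) (ℤ.<⇒≢ w<v)))))
      where w<v = subst (ℤ._< c v) (sym w≡u) u<v
    ... | tri> _ _ u<w | tri< w<v _ _ = contradiction (least w u<w) (ℤ.<⇒≱ w<v)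
    ... | tri> _ w≢u u<w | tri≈ _ w≡v _ = trans (sgn-> u<w) (sym (cong₂ _+_ (sgn-≡ w≡v)
      (cong₂ _+_ (⟦⟧-false (c w ℤ.≟ c u) w≢u) (⟦⟧-true (c w ℤ.≟ c v) w≡v))))
    ... | tri> _ w≢u u<w | tri> _ w≢v v<w = trans (sgn-> u<w) (sym (cong₂ _+_ (sgn-> v<w)
      (cong₂ _+_ (⟦⟧-false (c w ℤ.≟ c u) w≢u) (⟦⟧-false (c w ℤ.≟ c v) w≢v))))

  -- Here `net c v` is the last summand, as in `fire c v`, so comparing the two firings cancels it
  -- and leaves the inequality of `Narrow`.
  fire-adjacent : ∀ c {u v} → Adjacent c u v → fire c u ≡ c u + + levels c u v + net c v
  fire-adjacent c {u} {v} adj = begin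
    fire c u                              ≡⟨ fire≡c+net c u ⟩
    c u + net c u                         ≡⟨ cong (_+_ (c u)) (net-adjacent c adj) ⟩
    c u + (net c v + + levels c u v)      ≡⟨ cong (_+_ (c u)) (ℤ.+-comm (net c v) _) ⟩
    c u + (+ levels c u v + net c v)      ≡⟨ ℤ.+-assoc (c u) _ _ ⟨
    c u + + levels c u v + net c v        ∎
    where open ≡-Reasoning

  reversing⇒narrow : ∀ {c} → Reversing c → Narrow c
  reversing⇒narrow {c} rev u v adj@(u<v , _) = +-cancelʳ-< (net c v)
    (subst₂ ℤ._<_ (fire≡c+net c v) (fire-adjacent c adj) (rev u v u<v))

  narrow⇒reversing-adjacent : ∀ {c} → Narrow c → ∀ {u v} → Adjacent c u v → fire c v ℤ.< fire c u
  narrow⇒reversing-adjacent {c} narrow {u} {v} adj =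
    subst₂ ℤ._<_ (sym (fire≡c+net c v)) (sym (fire-adjacent c adj)) (ℤ.+-monoˡ-< (net c v) (narrow u v adj))

  narrow⇒reversing : ∀ {c} → Narrow c → Reversing c
  narrow⇒reversing {c} narrow u v u<v = let m , v≤u+m = bounded (c u) c in reverse m u v (v≤u+m v) u<v
    where
    -- m bounds the difference c v - c u; a non-adjacent pair is split at a value in between.
    reverse : ∀ m u v → c v ℤ.≤ c u + + m → c u ℤ.< c v → fire c v ℤ.< fire c u
    reverse zero    u v v≤u u<v = contradiction (subst (c v ℤ.≤_) (ℤ.+-identityʳ (c u)) v≤u) (ℤ.<⇒≱ u<v)
    reverse (suc m) u v v≤u+1+m u<v with any? (λ w → (c u ℤ.<? c w) ×-dec (c w ℤ.<? c v))
    ... | no none = narrow⇒reversing-adjacent narrow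
      (u<v , λ w u<w → ℤ.≮⇒≥ (λ w<v → none (w , u<w , w<v)))
    ... | yes (w , u<w , w<v) = ℤ.<-trans
      (reverse m w v (≤-shift u<w v≤u+1+m) w<v)
      (reverse m u w (<⇒≤-pred {k = c u} w<v v≤u+1+m) u<w)

  -- Stacks of level sets

  record LevelAt (c : Configuration n) (a : ℤ) (B : Subset n) : Set where
    constructor levelAt
    field
      inhabited : Nonempty B
      isLevel   : B ≡ level c a

  open LevelAt

  -- Stacked c a Bs gs: the level sets of c at heights a and above are, from the
  -- bottom up, Bs, and the gaps between them are the successors of gs.
  data Stacked (c : Configuration n) : ℤ → List (Subset n) → List ℕ → Set where
    top   : ∀ {a B} → LevelAt c a B → (∀ v → c v ℤ.≤ a) → Stacked c a (B ∷ []) []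
    layer : ∀ {a b g B C Bs gs} → LevelAt c a B → b ≡ a + +[1+ g ] → (∀ v → a ℤ.< c v → b ℤ.≤ c v) →
            Stacked c b (C ∷ Bs) gs → Stacked c a (B ∷ C ∷ Bs) (g ∷ gs)

  bottom : ∀ {c a B Bs gs} → Stacked c a (B ∷ Bs) gs → LevelAt c a B
  bottom (top lv _)       = lv
  bottom (layer lv _ _ _) = lv

  ∈-levelAt : ∀ {c a B v} → LevelAt c a B → v ∈ B → c v ≡ a
  ∈-levelAt {c} (levelAt _ refl) = ∈-level⁻ c

  levelAt-∋ : ∀ {c a B v} → LevelAt c a B → c v ≡ a → v ∈ B
  levelAt-∋ {c} (levelAt _ refl) = ∈-level⁺ c

  attained : ∀ {c a B Bs gs} → Stacked c a (B ∷ Bs) gs → ∃ λ v → c v ≡ a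
  attained st = let lv@(levelAt (v , v∈B) _) = bottom st in v , ∈-levelAt lv v∈B

  attained-above : ∀ {c a b B Bs gs g} → b ≡ a + +[1+ g ] → Stacked c b (B ∷ Bs) gs → ∃ λ v → a ℤ.< c v × c v ≡ b
  attained-above {a = a} b≡ st = let v , v≡b = attained st in
    v , subst (a ℤ.<_) (sym (trans v≡b b≡)) (i<i+1+n a _) , v≡b

  stacked-cong : ∀ {c d a Bs gs} → c ≗ d → Stacked c a Bs gs → Stacked d a Bs gs
  stacked-cong {c} {d} c≗d = go
    where
    levelAt-cong : ∀ {a B} → LevelAt c a B → LevelAt d a B
    levelAt-cong {a} (levelAt ne B≡) = levelAt ne (trans B≡ (tabulate-cong (λ v → cong (λ i → does (i ℤ.≟ a)) (c≗d v))))
    go : ∀ {a Bs gs} → Stacked c a Bs gs → Stacked d a Bs gs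
    go (top lv max)         = top (levelAt-cong lv) (λ v → subst (ℤ._≤ _) (c≗d v) (max v))
    go (layer lv b≡ gap st) = layer (levelAt-cong lv) b≡
      (λ v a<v → subst (_ ℤ.≤_) (c≗d v) (gap v (subst (_ ℤ.<_) (sym (c≗d v)) a<v))) (go st)

  -- The height determines the bottom block. The next height is attained in both stacks and is a
  -- lower bound for all values above `a` in both, so the two next heights agree, and with them the
  -- gaps. A top level cannot face a layer, since a layer has a vertex above `a`.
  stacked-unique : ∀ {c a Bs gs Cs hs} → Stacked c a Bs gs → Stacked c a Cs hs → (Bs , gs) ≡ (Cs , hs)
  stacked-unique (top (levelAt _ refl) _) (top (levelAt _ refl) _) = refl
  stacked-unique (top _ max) (layer _ b≡ _ st) =
    let v , a<v , _ = attained-above b≡ st in contradiction (max v) (ℤ.<⇒≱ a<v)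
  stacked-unique (layer _ b≡ _ st) (top _ max) =
    let v , a<v , _ = attained-above b≡ st in contradiction (max v) (ℤ.<⇒≱ a<v)
  stacked-unique {a = a} (layer (levelAt _ refl) b≡ gap st) (layer (levelAt _ refl) b′≡ gap′ st′)
    with ℤ.≤-antisym
      (let v , a<v , v≡b′ = attained-above b′≡ st′ in subst (_ ℤ.≤_) v≡b′ (gap v a<v))
      (let v , a<v , v≡b = attained-above b≡ st in subst (_ ℤ.≤_) v≡b (gap′ v a<v))
  ... | refl with gap-injective a (trans (sym b≡) b′≡) | stacked-unique st st′
  ...   | refl | refl = refl

  -- Recovers `c` from its code up to the shift by `a`; a vertex outside the bottom block lies
  -- strictly above `a`, hence in the rest of the stack.
  stacked-height : ∀ {c a Bs gs} → Stacked c a Bs gs → ∀ v → a ℤ.≤ c v → c v ≡ a + + height Bs gs v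
  stacked-height {c} {a} (top _ max) v a≤v = trans (ℤ.≤-antisym (max v) a≤v) (sym (ℤ.+-identityʳ a))
  stacked-height {c} {a} (layer {b = b} {g} {B} {C} {Bs} {gs} lv refl gap st) v a≤v with v ∈? B
  ... | yes v∈B = trans (∈-levelAt lv v∈B) (sym (ℤ.+-identityʳ a))
  ... | no  v∉B = trans
    (stacked-height st v (gap v (ℤ.≤∧≢⇒< a≤v (v∉B ∘ levelAt-∋ lv ∘ sym))))
    (ℤ.+-assoc a +[1+ g ] (+ height (C ∷ Bs) gs v))

  stacked-exists : ∀ c m v → (∀ w → c w ℤ.≤ c v + + m) →
    ∃ λ B → ∃ λ Bs → ∃ λ gs → Stacked c (c v) (B ∷ Bs) gs
  stacked-exists c m v w≤v+m = go m v w≤v+m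
    where
    levelOf : ∀ v → LevelAt c (c v) (level c (c v))
    levelOf v = levelAt (v , ∈-level⁺ c refl) refl
    -- m bounds the height of c above c v.
    go : ∀ m v → (∀ w → c w ℤ.≤ c v + + m) → ∃ λ B → ∃ λ Bs → ∃ λ gs → Stacked c (c v) (B ∷ Bs) gs
    go zero    v max = _ , _ , _ , top (levelOf v) (λ w → subst (c w ℤ.≤_) (ℤ.+-identityʳ (c v)) (max w))
    go (suc m) v max with least (λ w → c v ℤ.<? c w) c
    ... | inj₁ none = _ , _ , _ , top (levelOf v) (ℤ.≮⇒≥ ∘ none)
    ... | inj₂ (u , v<u , min) = let
        g , u≡ = <⇒gap v<u
        B , Bs , gs , st = go m u (λ w → ≤-shift v<u (max w))
      in _ , _ , _ , layer (levelOf v) u≡ min st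

  stacked-above : ∀ {c a Bs gs B v} → Stacked c a Bs gs → B ∈ˡ Bs → v ∈ B → a ℤ.≤ c v
  stacked-above (top lv _) (here refl) v∈B = ℤ.≤-reflexive (sym (∈-levelAt lv v∈B))
  stacked-above (layer lv _ _ _) (here refl) v∈B = ℤ.≤-reflexive (sym (∈-levelAt lv v∈B))
  stacked-above (layer _ refl _ st) (there B∈) v∈B = ℤ.≤-trans (ℤ.<⇒≤ (i<i+1+n _ _)) (stacked-above st B∈ v∈B)

  stacked-nonempty : ∀ {c a Bs gs} → Stacked c a Bs gs → All Nonempty Bs
  stacked-nonempty (top lv _)        = inhabited lv ∷ []
  stacked-nonempty (layer lv _ _ st) = inhabited lv ∷ stacked-nonempty st

  stacked-disjoint : ∀ {c a Bs gs} → Stacked c a Bs gs → AllPairs Disjoint Bs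
  stacked-disjoint (top _ _) = [] ∷ []
  stacked-disjoint {c} {a} (layer {g = g} {B = B} {C} {Bs} lv refl _ st) = All.tabulate disjoint ∷ stacked-disjoint st
    where
    disjoint : ∀ {D} → D ∈ˡ C ∷ Bs → Disjoint B D
    disjoint {D} D∈ (v , v∈) = let v∈B , v∈D = x∈p∩q⁻ B D v∈ in
      ℤ.<⇒≱ (i<i+1+n a g) (subst (a + +[1+ g ] ℤ.≤_) (∈-levelAt lv v∈B) (stacked-above st D∈ v∈D))

  stacked-covers : ∀ {c a Bs gs} → Stacked c a Bs gs → ∀ v → a ℤ.≤ c v → Any (v ∈_) Bs
  stacked-covers (top lv max) v a≤v = here (levelAt-∋ lv (ℤ.≤-antisym (max v) a≤v))
  stacked-covers (layer {B = B} lv _ gap st) v a≤v with v ∈? B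
  ... | yes v∈B = here v∈B
  ... | no  v∉B = there (stacked-covers st v (gap v (ℤ.≤∧≢⇒< a≤v (v∉B ∘ levelAt-∋ lv ∘ sym))))

  stacked⇒isOrderedPartition : ∀ {c a Bs gs} → Stacked c a Bs gs → (∀ v → a ℤ.≤ c v) → IsOrderedPartition Bs
  stacked⇒isOrderedPartition st a≤c = mkIsOrderedPartition
    (stacked-nonempty st) (stacked-disjoint st) (λ v → stacked-covers st v (a≤c v))

  -- If `u` lies in the bottom block, `v` is at the next height and the claim is the bound on the
  -- entry `g`; otherwise the pair belongs to the rest of the stack.
  stacked-narrow⁺ : ∀ {c a Bs gs} → Stacked c a Bs gs → gs ∈ˡ gapLists Bs →
    ∀ u v → a ℤ.≤ c u → Adjacent c u v → c v ℤ.< c u + + levels c u v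
  stacked-narrow⁺ (top _ max) _ u v a≤u (u<v , _) =
    contradiction (ℤ.≤-trans (max v) a≤u) (ℤ.<⇒≱ u<v)
  stacked-narrow⁺ {c} {a} (layer {g = g} {B = B} {C = C} {Bs = Bs} lv b≡ gap st) gs∈ u v a≤u adj@(u<v , min)
    with ∈-cartesianProductWith⁻ _∷_ (upTo (∣ B ∣ ℕ.+ ∣ C ∣ ℕ.∸ 1)) (gapLists (C ∷ Bs)) gs∈ | u ∈? B
  ... | _ , _ , _  , gs∈′ , refl | no u∉B =
    stacked-narrow⁺ st gs∈′ u v (gap u (ℤ.≤∧≢⇒< a≤u (u∉B ∘ levelAt-∋ lv ∘ sym))) adj
  ... | _ , _ , g∈ , _    , refl | yes u∈B = subst₂ (λ i j → i ℤ.< c u + + j)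
    (trans (cong (_+ +[1+ g ]) u≡a) (sym (trans v≡b b≡)))
    (cong₂ (λ D E → ∣ D ∣ ℕ.+ ∣ E ∣)
      (trans (isLevel lv) (cong (level c) (sym u≡a)))
      (trans (isLevel (bottom st)) (cong (level c) (sym v≡b))))
    (ℤ.+-monoʳ-< (c u) (+<+ (<-pred⁻ {n = ∣ B ∣ ℕ.+ ∣ C ∣} (∈-upTo⁻ g∈))))
    where
    u≡a = ∈-levelAt lv u∈B
    -- Some vertex attains `b`, so minimality of `v` gives one inequality; the empty gap below `b`
    -- gives the other.
    v≡b = let w , a<w , w≡b = attained-above b≡ st in ℤ.≤-antisym
      (subst (c v ℤ.≤_) w≡b (min w (subst (ℤ._< c w) (sym u≡a) a<w)))
      (gap v (subst (ℤ._< c v) u≡a u<v))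

  stacked-narrow⁻ : ∀ {c a Bs gs} → Narrow c → Stacked c a Bs gs → gs ∈ˡ gapLists Bs
  stacked-narrow⁻ narrow (top _ _) = here refl
  stacked-narrow⁻ {c} {a} narrow (layer {g = g} {B} {C} lv@(levelAt (u , u∈B) refl) refl gap st) =
    ∈-cartesianProductWith⁺ _∷_ (∈-upTo⁺ (<-pred⁺ (+-cancelˡ-<-pos a narrow-uv))) (stacked-narrow⁻ narrow st)
    where
    u≡a = ∈-levelAt lv u∈B
    narrow-uv : a + +[1+ g ] ℤ.< a + + (∣ level c a ∣ ℕ.+ ∣ C ∣)
    narrow-uv = let v , a<v , v≡b = attained-above refl st in
      subst₂ ℤ._<_ v≡b
        (cong₂ (λ i D → i + + (∣ level c i ∣ ℕ.+ ∣ D ∣)) u≡a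
          (trans (cong (level c) v≡b) (sym (isLevel (bottom st)))))
        (narrow u v (subst (ℤ._< c v) (sym u≡a) a<v ,
          λ w u<w → subst (ℤ._≤ c w) (sym v≡b) (gap w (subst (ℤ._< c w) u≡a u<w))))

  -- Generalised to a tail of the partition for the induction: vertices of earlier blocks lie below
  -- `a`, as the last hypothesis demands. For the whole partition that hypothesis is vacuous because
  -- the blocks cover everything.
  height-stacked : ∀ {c a} B Bs {gs} → gs ∈ˡ gapLists (B ∷ Bs) →
    All Nonempty (B ∷ Bs) → AllPairs Disjoint (B ∷ Bs) →
    (∀ {v} → Any (v ∈_) (B ∷ Bs) → c v ≡ a + + height (B ∷ Bs) gs v) →
    (∀ {v} → ¬ Any (v ∈_) (B ∷ Bs) → c v ℤ.< a) →
    Stacked c a (B ∷ Bs) gs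
  height-stacked {c} {a} B [] (here refl) (ne ∷ []) _ inside≡ outside< =
    top (levelAt ne (≡-level B⇒a a⇒B)) max
    where
    B⇒a : ∀ {v} → v ∈ B → c v ≡ a
    B⇒a v∈B = trans (inside≡ (here v∈B)) (ℤ.+-identityʳ a)
    ∉⇒< : ∀ {v} → v ∉ B → c v ℤ.< a
    ∉⇒< v∉B = outside< λ { (here v∈B) → v∉B v∈B }
    a⇒B : ∀ {v} → c v ≡ a → v ∈ B
    a⇒B {v} v≡a with v ∈? B
    ... | yes v∈B = v∈B
    ... | no  v∉B = contradiction v≡a (ℤ.<⇒≢ (∉⇒< v∉B))
    max : ∀ v → c v ℤ.≤ a
    max v with v ∈? B
    ... | yes v∈B = ℤ.≤-reflexive (B⇒a v∈B)
    ... | no  v∉B = ℤ.<⇒≤ (∉⇒< v∉B)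
  height-stacked {c} {a} B (C ∷ Bs) gs∈ (ne ∷ nes) (B#Bs ∷ disj) inside≡ outside<
    with ∈-cartesianProductWith⁻ _∷_ (upTo (∣ B ∣ ℕ.+ ∣ C ∣ ℕ.∸ 1)) (gapLists (C ∷ Bs)) gs∈
  ... | g , gs , _ , gs∈′ , refl =
    layer (levelAt ne (≡-level B⇒a a⇒B)) refl gap (height-stacked C Bs gs∈′ nes disj above≡ below<)
    where
    B⇒a : ∀ {v} → v ∈ B → c v ≡ a
    B⇒a {v} v∈B = trans (inside≡ (here v∈B))
      (trans (cong (λ h → a + + h) (height-∈ {Bs = C ∷ Bs} {g} {gs} v∈B)) (ℤ.+-identityʳ a))
    above≡ : ∀ {v} → Any (v ∈_) (C ∷ Bs) → c v ≡ a + +[1+ g ] + + height (C ∷ Bs) gs v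
    above≡ {v} v∈ = trans (inside≡ (there v∈))
      (trans (cong (λ h → a + + h) (height-∉ {Bs = C ∷ Bs} {g} {gs} v∉B)) (sym (ℤ.+-assoc a +[1+ g ] _)))
      where
      v∉B : v ∉ B
      v∉B v∈B = let D , D∈ , v∈D = find v∈ in All.lookup B#Bs D∈ (v , x∈p∩q⁺ (v∈B , v∈D))
    above≥ : ∀ {v} → Any (v ∈_) (C ∷ Bs) → a + +[1+ g ] ℤ.≤ c v
    above≥ {v} v∈ = subst (a + +[1+ g ] ℤ.≤_) (sym (above≡ v∈)) (ℤ.i≤i+j _ _)
    ∉⇒< : ∀ {v} → v ∉ B → ¬ Any (v ∈_) (C ∷ Bs) → c v ℤ.< a
    ∉⇒< v∉B v∉ = outside< λ { (here v∈B) → v∉B v∈B ; (there v∈) → v∉ v∈ }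
    a⇒B : ∀ {v} → c v ≡ a → v ∈ B
    a⇒B {v} v≡a with v ∈? B | Any.any? (v ∈?_) (C ∷ Bs)
    ... | yes v∈B | _      = v∈B
    ... | no  v∉B | yes v∈ = contradiction (subst (a + +[1+ g ] ℤ.≤_) v≡a (above≥ v∈)) (ℤ.<⇒≱ (i<i+1+n a g))
    ... | no  v∉B | no  v∉ = contradiction v≡a (ℤ.<⇒≢ (∉⇒< v∉B v∉))
    below< : ∀ {v} → ¬ Any (v ∈_) (C ∷ Bs) → c v ℤ.< a + +[1+ g ]
    below< {v} v∉ with v ∈? B
    ... | yes v∈B = subst (ℤ._< a + +[1+ g ]) (sym (B⇒a v∈B)) (i<i+1+n a g)
    ... | no  v∉B = ℤ.<-trans (∉⇒< v∉B v∉) (i<i+1+n a g)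
    gap : ∀ v → a ℤ.< c v → a + +[1+ g ] ℤ.≤ c v
    gap v a<v with Any.any? (v ∈?_) (C ∷ Bs) | v ∈? B
    ... | yes v∈ | _       = above≥ v∈
    ... | no  v∉ | yes v∈B = contradiction (sym (B⇒a v∈B)) (ℤ.<⇒≢ a<v)
    ... | no  v∉ | no  v∉B = contradiction a<v (ℤ.<-asym (∉⇒< v∉B v∉))

  -- Codes correspond to period classes

  module _ (v₀ : Fin n) where

    config-stacked : ∀ {Bs gs} → IsOrderedPartition Bs → gs ∈ˡ gapLists Bs →
      ∃ λ B → ∃ λ Cs → Bs ≡ B ∷ Cs × Stacked (config Bs gs) 0ℤ (B ∷ Cs) gs
    -- The empty list of blocks does not cover `v₀`.
    config-stacked {[]} part _ with () ← IsOrderedPartition.covers part v₀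
    config-stacked {B ∷ Bs} part gs∈ = B , Bs , refl , height-stacked B Bs gs∈ nonempty disjoint
      (λ _ → sym (ℤ.+-identityˡ _)) (λ {v} v∉ → contradiction (covers v) v∉)
      where open IsOrderedPartition part

    config-period : ∀ {Bs gs} → (Bs , gs) ∈ˡ codes n → IsPeriod (config Bs gs)
    config-period {Bs} {gs} x∈ with part , gs∈ ← ∈-codes⁻ x∈ with _ , _ , refl , st ← config-stacked part gs∈ =
      reversing⇒period (narrow⇒reversing (λ u v → stacked-narrow⁺ st gs∈ u v (+≤+ z≤n)))

    -- Both configurations are nonnegative and attain 0, which forces the shift `k` to be 0; then
    -- `stacked-unique` applies.
    config-injective : ∀ {Bs gs Cs hs} → (Bs , gs) ∈ˡ codes n → (Cs , hs) ∈ˡ codes n →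
      config Bs gs ∼ config Cs hs → (Bs , gs) ≡ (Cs , hs)
    config-injective {Bs} {gs} {Cs} {hs} x∈ y∈ (k , d≡c+k)
      with part , gs∈ ← ∈-codes⁻ x∈ | part′ , hs∈ ← ∈-codes⁻ y∈
      with _ , _ , refl , st ← config-stacked part gs∈ | _ , _ , refl , st′ ← config-stacked part′ hs∈ =
      stacked-unique (stacked-cong c≗d st) st′
      where
      c = config Bs gs
      d = config Cs hs
      0≤k : 0ℤ ℤ.≤ k
      0≤k = let v , v≡0 = attained st in
        subst (0ℤ ℤ.≤_) (trans (d≡c+k v) (trans (cong (_+ k) v≡0) (ℤ.+-identityˡ k))) (+≤+ z≤n)
      k≤0 : k ℤ.≤ 0ℤ
      k≤0 = let v , v≡0 = attained st′ in
        subst₂ ℤ._≤_ (ℤ.+-identityˡ k) (trans (sym (d≡c+k v)) v≡0) (ℤ.+-monoˡ-≤ k (+≤+ z≤n))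
      c≗d : c ≗ d
      c≗d v = sym (trans (d≡c+k v) (trans (cong (_+_ (c v)) (ℤ.≤-antisym k≤0 0≤k)) (ℤ.+-identityʳ (c v))))

    -- The code is read off upwards from a lowest stack `v`, and the shift is `c v`.
    config-surjective : ∀ {c} → IsPeriod c → ∃ λ x → x ∈ˡ codes n × config (proj₁ x) (proj₂ x) ∼ c
    config-surjective {c} period with least {P = λ _ → ⊤} (λ _ → yes tt) c
    ... | inj₁ none = contradiction tt (none v₀)
    ... | inj₂ (v , _ , min) = let
        m , c≤v+m = bounded (c v) c
        B , Bs , gs , st = stacked-exists c m v c≤v+m
        v≤c = λ w → min w tt
      in (B ∷ Bs , gs)
       , ∈-codes⁺ (stacked⇒isOrderedPartition st v≤c)
                  (stacked-narrow⁻ (reversing⇒narrow (period⇒reversing period)) st)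
       , c v , λ w → trans (stacked-height st w (v≤c w)) (ℤ.+-comm (c v) _)

theorem5p1 : (n : ℕ) → 1 ≤ n →
    HasCardinality (periodClasses (complete n)) (sum (map blockProduct (orderedPartitions n)))
theorem5p1 zero    ()
theorem5p1 (suc n) _ = subst (HasCardinality (periodClasses (complete (suc n)))) (length-codes (suc n))
  (enumeration⇒HasCardinality (periodClasses (complete (suc n))) (codes-unique (suc n))
    (λ {x} x∈ → config (proj₁ x) (proj₂ x) , config-period zero x∈)
    (config-injective zero)
    (λ (_ , period) → let x , x∈ , x∼c = config-surjective zero period in x , x∈ , λ _ → x∼c))
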